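{- Let $P$ be a finite poset and fix a real number $q\geq 0$. For $p\in P$ let $T_p^q\colon \mathcal{J}(P)\to\mathbb{R}$ be the statistic $T_p^q\coloneqq T_p^+-q\,T_p^-$. Then the statistics $T_p^q$ ($p\in P$) are linearly independent over $\mathbb{R}$, and they are also linearly independent from the constant function $1$ (i.e., $1\notin\operatorname{span}_{\mathbb{R}}\{T_p^q\colon p\in P\}$).
   Context: $\mathcal{J}(P)$ denotes the set of order ideals (downward-closed subsets) of $P$. For $p\in P$ and $I\in\mathcal{J}(P)$: $T_p^+(I)=1$ if $p$ is a minimal element of $P\setminus I$ and $0$ otherwise; $T_p^-(I)=1$ if $p$ is a maximal element of $I$ and $0$ otherwise. -}

module Defs where

open import Algebra.Bundles using (CommutativeRing)
import Algebra.Properties.Semiring.Sum as SemiringSum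
open import Data.Bool.Base using (if_then_else_)
open import Data.Fin.Base using (Fin)
open import Data.Fin.Properties using (all?)
import Data.Fin.Properties as Fin
open import Data.Fin.Subset using (Subset; _∈_; ∁)
open import Data.Fin.Subset.Properties using (_∈?_)
open import Data.Nat.Base as ℕ using (ℕ; _⊔_)
import Data.Nat.Properties as ℕ
open import Data.Product.Base using (∃; _×_; _,_)
open import Data.Rational.Base as ℚ using (ℚ; 0ℚ; 1ℚ; ½; ∣_∣; 1/_)
import Data.Rational.Properties as ℚ
open import Data.Rational.Solver using (module +-*-Solver)
open import Level using (Level; 0ℓ)
open import Relation.Binary.Core using (Rel)
open import Relation.Binary.Definitions using (Decidable)
open import Relation.Binary.PropositionalEquality
  using (_≡_; refl; sym; trans; cong; subst)
open import Relation.Binary.Structures using (IsDecPartialOrder)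
open import Relation.Nullary.Decidable using (Dec; does; _×-dec_; _→-dec_)
open import Relation.Nullary.Negation using (¬_)

-- Real numbers are Cauchy sequences of rationals; in place of a quotient,
-- their equality is the relation _≈_ "the difference tends to 0".

Eventually : (ℕ → Set) → Set
Eventually Q = ∃ λ N → ∀ {n} → N ℕ.≤ n → Q n

IsCauchy : (ℕ → ℚ) → Set
IsCauchy x = ∀ ε → 0ℚ ℚ.< ε →
  ∃ λ N → ∀ {m n} → N ℕ.≤ m → N ℕ.≤ n → ∣ x m ℚ.- x n ∣ ℚ.< ε

record ℝ : Set where
  constructor mkℝ
  field
    seq    : ℕ → ℚ
    cauchy : IsCauchy seq

open ℝ public

infix 4 _≈_ _≤_

-- Records, so that the two real numbers can be inferred from a proof.
record _≈_ (x y : ℝ) : Set where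
  constructor mk≈
  field
    close : ∀ ε → 0ℚ ℚ.< ε →
      Eventually λ n → ∣ seq x n ℚ.- seq y n ∣ ℚ.< ε

record _≤_ (x y : ℝ) : Set where
  constructor mk≤
  field
    below : ∀ ε → 0ℚ ℚ.< ε →
      Eventually λ n → seq x n ℚ.< seq y n ℚ.+ ε

open _≈_ public
open _≤_ public

private

  halve : ∀ {ε} → 0ℚ ℚ.< ε → 0ℚ ℚ.< ε ℚ.* ½
  halve {ε} 0<ε = ℚ.positive⁻¹ (ε ℚ.* ½)
    {{ℚ.pos*pos⇒pos ε {{ℚ.positive 0<ε}} ½}}

  halves : ∀ ε → ε ℚ.* ½ ℚ.+ ε ℚ.* ½ ≡ ε
  halves ε = trans (sym (ℚ.*-distribˡ-+ ε ½ ½)) (ℚ.*-identityʳ ε)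

  ∣-∣-sym : ∀ a b → ∣ a ℚ.- b ∣ ≡ ∣ b ℚ.- a ∣
  ∣-∣-sym a b = trans (sym (ℚ.∣-p∣≡∣p∣ (a ℚ.- b)))
    (cong ∣_∣ (solve 2 (λ a b → :- (a :- b) := b :- a) refl a b))
    where open +-*-Solver

  ∣-∣-self : ∀ {a b} → a ≡ b → ∀ {ε} → 0ℚ ℚ.< ε → ∣ a ℚ.- b ∣ ℚ.< ε
  ∣-∣-self {a} refl 0<ε = subst (ℚ._< _) (sym (cong ∣_∣ (ℚ.+-inverseʳ a))) 0<ε

  split : ∀ {a b ε} c → c ≡ a ℚ.+ b →
    ∣ a ∣ ℚ.< ε ℚ.* ½ → ∣ b ∣ ℚ.< ε ℚ.* ½ → ∣ c ∣ ℚ.< ε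
  split {a} {b} {ε} _ refl a<ε b<ε = ℚ.≤-<-trans (ℚ.∣p+q∣≤∣p∣+∣q∣ a b)
    (subst (∣ a ∣ ℚ.+ ∣ b ∣ ℚ.<_) (halves ε) (ℚ.+-mono-< a<ε b<ε))

  +-close : ∀ {ε} a b c d →
    ∣ a ℚ.- c ∣ ℚ.< ε ℚ.* ½ → ∣ b ℚ.- d ∣ ℚ.< ε ℚ.* ½ →
    ∣ (a ℚ.+ b) ℚ.- (c ℚ.+ d) ∣ ℚ.< ε
  +-close a b c d = split _
    (solve 4 (λ a b c d → (a :+ b) :- (c :+ d) := (a :- c) :+ (b :- d)) refl a b c d)
    where open +-*-Solver

  neg-close : ∀ a b → ∣ (ℚ.- a) ℚ.- (ℚ.- b) ∣ ≡ ∣ a ℚ.- b ∣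
  neg-close a b = trans
    (cong ∣_∣ (solve 2 (λ a b → (:- a) :- (:- b) := :- (a :- b)) refl a b))
    (ℚ.∣-p∣≡∣p∣ (a ℚ.- b))
    where open +-*-Solver

  module Scale {M ε : ℚ} (0<M : 0ℚ ℚ.< M) (0<ε : 0ℚ ℚ.< ε) where

    instance
      M-pos : ℚ.Positive M
      M-pos = ℚ.positive 0<M

      M-nonZero : ℚ.NonZero M
      M-nonZero = ℚ.pos⇒nonZero M

    δ : ℚ
    δ = 1/ M ℚ.* (ε ℚ.* ½)

    0<δ : 0ℚ ℚ.< δ
    0<δ = ℚ.positive⁻¹ δ
      {{ℚ.pos*pos⇒pos (1/ M) {{ℚ.1/pos⇒pos M}} (ε ℚ.* ½) {{ℚ.positive (halve 0<ε)}}}}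

    Mδ : M ℚ.* δ ≡ ε ℚ.* ½
    Mδ = trans (sym (ℚ.*-assoc M (1/ M) (ε ℚ.* ½)))
      (trans (cong (ℚ._* (ε ℚ.* ½)) (ℚ.*-inverseʳ M)) (ℚ.*-identityˡ (ε ℚ.* ½)))

    scale : ∀ {a b} → ∣ a ∣ ℚ.< M → ∣ b ∣ ℚ.< δ → ∣ a ℚ.* b ∣ ℚ.< ε ℚ.* ½
    scale {a} {b} a<M b<δ = begin-strict
      ∣ a ℚ.* b ∣       ≡⟨ ℚ.∣p*q∣≡∣p∣*∣q∣ a b ⟩
      ∣ a ∣ ℚ.* ∣ b ∣   ≤⟨ ℚ.*-monoʳ-≤-nonNeg ∣ b ∣ {{ℚ.∣-∣-nonNeg b}} (ℚ.<⇒≤ a<M) ⟩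
      M ℚ.* ∣ b ∣       <⟨ ℚ.*-monoʳ-<-pos M b<δ ⟩
      M ℚ.* δ           ≡⟨ Mδ ⟩
      ε ℚ.* ½           ∎
      where open ℚ.≤-Reasoning

    *-close : ∀ a b c d → ∣ a ∣ ℚ.< M → ∣ d ∣ ℚ.< M →
      ∣ a ℚ.- c ∣ ℚ.< δ → ∣ b ℚ.- d ∣ ℚ.< δ →
      ∣ a ℚ.* b ℚ.- c ℚ.* d ∣ ℚ.< ε
    *-close a b c d a<M d<M ac bd = split _
      (solve 4 (λ a b c d → a :* b :- c :* d := a :* (b :- d) :+ d :* (a :- c))
        refl a b c d)
      (scale {a} a<M bd) (scale {d} d<M ac)
      where open +-*-Solver

  bounded : ∀ x → ∃ λ M → 0ℚ ℚ.< M × Eventually λ n → ∣ seq x n ∣ ℚ.< M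
  bounded x with cauchy x 1ℚ (ℚ.positive⁻¹ 1ℚ)
  ... | N , close = ∣ seq x N ∣ ℚ.+ 1ℚ
      , ℚ.+-mono-≤-< (ℚ.0≤∣p∣ (seq x N)) (ℚ.positive⁻¹ 1ℚ)
      , N , bound
    where
    bound : ∀ {n} → N ℕ.≤ n → ∣ seq x n ∣ ℚ.< ∣ seq x N ∣ ℚ.+ 1ℚ
    bound {n} N≤n = ℚ.≤-<-trans
      (subst (λ t → ∣ t ∣ ℚ.≤ ∣ seq x N ∣ ℚ.+ ∣ seq x n ℚ.- seq x N ∣)
        (solve 2 (λ a b → b :+ (a :- b) := a) refl (seq x n) (seq x N))
        (ℚ.∣p+q∣≤∣p∣+∣q∣ (seq x N) (seq x n ℚ.- seq x N)))
      (ℚ.+-monoʳ-< ∣ seq x N ∣ (close N≤n ℕ.≤-refl))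
      where open +-*-Solver

  <-sumˡ : ∀ {a A B} → a ℚ.< A → 0ℚ ℚ.< B → a ℚ.< A ℚ.+ B
  <-sumˡ {a} a<A 0<B = subst (ℚ._< _) (ℚ.+-identityʳ a) (ℚ.+-mono-< a<A 0<B)

  <-sumʳ : ∀ {b A B} → b ℚ.< B → 0ℚ ℚ.< A → b ℚ.< A ℚ.+ B
  <-sumʳ {b} b<B 0<A = subst (ℚ._< _) (ℚ.+-identityˡ b) (ℚ.+-mono-< 0<A b<B)

  bounded₂ : ∀ x y → ∃ λ M → 0ℚ ℚ.< M ×
    Eventually λ n → ∣ seq x n ∣ ℚ.< M × ∣ seq y n ∣ ℚ.< M
  bounded₂ x y =
    let A , 0<A , K , xA = bounded x
        B , 0<B , L , yB = bounded y
    in A ℚ.+ B , <-sumˡ 0<A 0<B , K ⊔ L , λ n≥ →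
         <-sumˡ (xA (ℕ.m⊔n≤o⇒m≤o K L n≥)) 0<B ,
         <-sumʳ (yB (ℕ.m⊔n≤o⇒n≤o K L n≥)) 0<A

fromℚ : ℚ → ℝ
fromℚ a = mkℝ (λ _ → a) (λ _ 0<ε → 0 , λ _ _ → ∣-∣-self {a} refl 0<ε)

0ℝ 1ℝ : ℝ
0ℝ = fromℚ 0ℚ
1ℝ = fromℚ 1ℚ

abstract

  +-cauchy : ∀ x y → IsCauchy λ n → seq x n ℚ.+ seq y n
  +-cauchy x y ε 0<ε =
    let K , xK = cauchy x (ε ℚ.* ½) (halve 0<ε)
        L , yL = cauchy y (ε ℚ.* ½) (halve 0<ε)
    in K ⊔ L , λ {m} {n} m≥ n≥ → +-close (seq x m) (seq y m) (seq x n) (seq y n)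
         (xK (ℕ.m⊔n≤o⇒m≤o K L m≥) (ℕ.m⊔n≤o⇒m≤o K L n≥))
         (yL (ℕ.m⊔n≤o⇒n≤o K L m≥) (ℕ.m⊔n≤o⇒n≤o K L n≥))

  neg-cauchy : ∀ x → IsCauchy λ n → ℚ.- seq x n
  neg-cauchy x ε 0<ε =
    let K , xK = cauchy x ε 0<ε
    in K , λ {m} {n} m≥ n≥ →
         subst (ℚ._< ε) (sym (neg-close (seq x m) (seq x n))) (xK m≥ n≥)

  *-cauchy : ∀ x y → IsCauchy λ n → seq x n ℚ.* seq y n
  *-cauchy x y ε 0<ε =
    let M , 0<M , B , xyB = bounded₂ x y
        open Scale 0<M 0<ε
        K , xK = cauchy x δ 0<δ
        L , yL = cauchy y δ 0<δ
        N = B ⊔ (K ⊔ L)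
        ≥B : ∀ {n} → N ℕ.≤ n → B ℕ.≤ n
        ≥B = ℕ.m⊔n≤o⇒m≤o B (K ⊔ L)
        ≥K : ∀ {n} → N ℕ.≤ n → K ℕ.≤ n
        ≥K n≥ = ℕ.m⊔n≤o⇒m≤o K L (ℕ.m⊔n≤o⇒n≤o B (K ⊔ L) n≥)
        ≥L : ∀ {n} → N ℕ.≤ n → L ℕ.≤ n
        ≥L n≥ = ℕ.m⊔n≤o⇒n≤o K L (ℕ.m⊔n≤o⇒n≤o B (K ⊔ L) n≥)
    in N , λ {m} {n} m≥ n≥ →
         let x<M , _ = xyB (≥B m≥)
             _ , y<M = xyB (≥B n≥)
         in *-close (seq x m) (seq y m) (seq x n) (seq y n) x<M y<M
              (xK (≥K m≥) (≥K n≥)) (yL (≥L m≥) (≥L n≥))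

infixl 6 _+_
infixl 7 _*_
infix  8 -_

_+_ : ℝ → ℝ → ℝ
x + y = mkℝ (λ n → seq x n ℚ.+ seq y n) (+-cauchy x y)

-_ : ℝ → ℝ
- x = mkℝ (λ n → ℚ.- seq x n) (neg-cauchy x)

_*_ : ℝ → ℝ → ℝ
x * y = mkℝ (λ n → seq x n ℚ.* seq y n) (*-cauchy x y)

private

  pointwise : ∀ {x y} → (∀ n → seq x n ≡ seq y n) → x ≈ y
  pointwise x≗y = mk≈ λ _ 0<ε → 0 , λ {n} _ → ∣-∣-self (x≗y n) 0<ε

  ≈-refl : ∀ x → x ≈ x
  ≈-refl x = pointwise λ _ → refl

  ≈-sym : ∀ {x y} → x ≈ y → y ≈ x
  ≈-sym {x} {y} x≈y = mk≈ λ ε 0<ε →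
    let K , xy = close x≈y ε 0<ε
    in K , λ {n} n≥ → subst (ℚ._< ε) (∣-∣-sym (seq x n) (seq y n)) (xy n≥)

  ≈-trans : ∀ {x y z} → x ≈ y → y ≈ z → x ≈ z
  ≈-trans {x} {y} {z} x≈y y≈z = mk≈ λ ε 0<ε →
    let K , xy = close x≈y (ε ℚ.* ½) (halve 0<ε)
        L , yz = close y≈z (ε ℚ.* ½) (halve 0<ε)
    in K ⊔ L , λ {n} n≥ → split _
         (solve 3 (λ x y z → x :- z := (x :- y) :+ (y :- z)) refl
           (seq x n) (seq y n) (seq z n))
         (xy (ℕ.m⊔n≤o⇒m≤o K L n≥)) (yz (ℕ.m⊔n≤o⇒n≤o K L n≥))
    where open +-*-Solver

  +-cong : ∀ {x y u v} → x ≈ y → u ≈ v → x + u ≈ y + v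
  +-cong {x} {y} {u} {v} x≈y u≈v = mk≈ λ ε 0<ε →
    let K , xy = close x≈y (ε ℚ.* ½) (halve 0<ε)
        L , uv = close u≈v (ε ℚ.* ½) (halve 0<ε)
    in K ⊔ L , λ {n} n≥ → +-close (seq x n) (seq u n) (seq y n) (seq v n)
         (xy (ℕ.m⊔n≤o⇒m≤o K L n≥)) (uv (ℕ.m⊔n≤o⇒n≤o K L n≥))

  -‿cong : ∀ {x y} → x ≈ y → - x ≈ - y
  -‿cong {x} {y} x≈y = mk≈ λ ε 0<ε →
    let K , xy = close x≈y ε 0<ε
    in K , λ {n} n≥ →
         subst (ℚ._< ε) (sym (neg-close (seq x n) (seq y n))) (xy n≥)

  *-cong : ∀ {x y u v} → x ≈ y → u ≈ v → x * u ≈ y * v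
  *-cong {x} {y} {u} {v} x≈y u≈v = mk≈ λ ε 0<ε →
    let M , 0<M , B , xvB = bounded₂ x v
        open Scale 0<M 0<ε
        K , xy = close x≈y δ 0<δ
        L , uv = close u≈v δ 0<δ
    in B ⊔ (K ⊔ L) , λ {n} n≥ →
         let KL≤n = ℕ.m⊔n≤o⇒n≤o B (K ⊔ L) n≥
             x<M , v<M = xvB (ℕ.m⊔n≤o⇒m≤o B (K ⊔ L) n≥)
         in *-close (seq x n) (seq u n) (seq y n) (seq v n) x<M v<M
              (xy (ℕ.m⊔n≤o⇒m≤o K L KL≤n)) (uv (ℕ.m⊔n≤o⇒n≤o K L KL≤n))

  +-assoc : ∀ x y z → (x + y) + z ≈ x + (y + z)
  +-assoc x y z = pointwise λ n → ℚ.+-assoc (seq x n) (seq y n) (seq z n)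

  +-comm : ∀ x y → x + y ≈ y + x
  +-comm x y = pointwise λ n → ℚ.+-comm (seq x n) (seq y n)

  +-identityˡ : ∀ x → 0ℝ + x ≈ x
  +-identityˡ x = pointwise λ n → ℚ.+-identityˡ (seq x n)

  +-identityʳ : ∀ x → x + 0ℝ ≈ x
  +-identityʳ x = pointwise λ n → ℚ.+-identityʳ (seq x n)

  -‿inverseˡ : ∀ x → (- x) + x ≈ 0ℝ
  -‿inverseˡ x = pointwise λ n → ℚ.+-inverseˡ (seq x n)

  -‿inverseʳ : ∀ x → x + (- x) ≈ 0ℝ
  -‿inverseʳ x = pointwise λ n → ℚ.+-inverseʳ (seq x n)

  *-assoc : ∀ x y z → (x * y) * z ≈ x * (y * z)
  *-assoc x y z = pointwise λ n → ℚ.*-assoc (seq x n) (seq y n) (seq z n)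

  *-comm : ∀ x y → x * y ≈ y * x
  *-comm x y = pointwise λ n → ℚ.*-comm (seq x n) (seq y n)

  *-identityˡ : ∀ x → 1ℝ * x ≈ x
  *-identityˡ x = pointwise λ n → ℚ.*-identityˡ (seq x n)

  *-identityʳ : ∀ x → x * 1ℝ ≈ x
  *-identityʳ x = pointwise λ n → ℚ.*-identityʳ (seq x n)

  distribˡ : ∀ x y z → x * (y + z) ≈ x * y + x * z
  distribˡ x y z = pointwise λ n → ℚ.*-distribˡ-+ (seq x n) (seq y n) (seq z n)

  distribʳ : ∀ x y z → (y + z) * x ≈ y * x + z * x
  distribʳ x y z = pointwise λ n → ℚ.*-distribʳ-+ (seq x n) (seq y n) (seq z n)

ℝ-commutativeRing : CommutativeRing 0ℓ 0ℓ
ℝ-commutativeRing = record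
  { Carrier = ℝ
  ; _≈_     = _≈_
  ; _+_     = _+_
  ; _*_     = _*_
  ; -_      = -_
  ; 0#      = 0ℝ
  ; 1#      = 1ℝ
  ; isCommutativeRing = record
    { isRing = record
      { +-isAbelianGroup = record
        { isGroup = record
          { isMonoid = record
            { isSemigroup = record
              { isMagma = record
                { isEquivalence = record
                  { refl  = λ {x} → ≈-refl x
                  ; sym   = ≈-sym
                  ; trans = ≈-trans
                  }
                ; ∙-cong = +-cong
                }
              ; assoc = +-assoc
              }
            ; identity = +-identityˡ , +-identityʳ
            }
          ; inverse = -‿inverseˡ , -‿inverseʳ
          ; ⁻¹-cong = -‿cong
          }
        ; comm = +-comm
        }
      ; *-cong     = *-cong
      ; *-assoc    = *-assoc
      ; *-identity = *-identityˡ , *-identityʳ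
      ; distrib    = distribˡ , distribʳ
      }
    ; *-comm = *-comm
    }
  }

open CommutativeRing ℝ-commutativeRing public using (_-_)
open SemiringSum (CommutativeRing.semiring ℝ-commutativeRing) public using (sum)

module _ {a} {X : Set a} {m : ℕ} where

  infix 4 _∈Span_

  linearCombination : (Fin m → ℝ) → (Fin m → X → ℝ) → X → ℝ
  linearCombination c f x = sum λ i → c i * f i x

  LinearlyIndependent : (Fin m → X → ℝ) → Set a
  LinearlyIndependent f = ∀ (c : Fin m → ℝ) →
    (∀ x → linearCombination c f x ≈ 0ℝ) → ∀ i → c i ≈ 0ℝ

  _∈Span_ : (X → ℝ) → (Fin m → X → ℝ) → Set a
  g ∈Span f = ∃ λ (c : Fin m → ℝ) → ∀ x → g x ≈ linearCombination c f x

-- A finite poset has ground set Fin n without loss of generality.  Its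
-- order is decidable, as is automatic classically, so that the 0/1-valued
-- statistics below can be computed.
module Toggleability
  {ℓ : Level} {n : ℕ} {_⊑_ : Rel (Fin n) ℓ}
  (isDecPartialOrder : IsDecPartialOrder _≡_ _⊑_)
  where

  open IsDecPartialOrder isDecPartialOrder using () renaming (_≤?_ to _⊑?_)

  record OrderIdeal : Set ℓ where
    field
      members    : Subset n
      downClosed : ∀ {x y} → x ⊑ y → y ∈ members → x ∈ members

  open OrderIdeal public

  IsMinimalIn IsMaximalIn : Fin n → Subset n → Set ℓ
  IsMinimalIn p S = p ∈ S × (∀ x → x ∈ S → x ⊑ p → x ≡ p)
  IsMaximalIn p S = p ∈ S × (∀ x → x ∈ S → p ⊑ x → x ≡ p)

  isMinimalIn? : Decidable IsMinimalIn
  isMinimalIn? p S =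
    (p ∈? S) ×-dec all? λ x → (x ∈? S) →-dec ((x ⊑? p) →-dec (x Fin.≟ p))

  isMaximalIn? : Decidable IsMaximalIn
  isMaximalIn? p S =
    (p ∈? S) ×-dec all? λ x → (x ∈? S) →-dec ((p ⊑? x) →-dec (x Fin.≟ p))

  indicator : ∀ {a} {A : Set a} → Dec A → ℝ
  indicator A? = if does A? then 1ℝ else 0ℝ

  T⁺ T⁻ : Fin n → OrderIdeal → ℝ
  T⁺ p I = indicator (isMinimalIn? p (∁ (members I)))
  T⁻ p I = indicator (isMaximalIn? p (members I))

  T : ℝ → Fin n → OrderIdeal → ℝ
  T q p I = T⁺ p I - q * T⁻ p I

{-# OPTIONS --safe #-}

-- Fix an order ideal B and give each order ideal S ⊆ B the weight q^|B ∖ S|.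
-- If x ∈ B, then removing x from S multiplies the weight by q, so the weighted
-- sum of T⁺ₓ equals q times that of T⁻ₓ, and that of Tₓ vanishes.
--
-- For B = P all the Tₓ have weighted sum 0, while that of 1 is at least the
-- term S = P, which is 1; hence 1 is not in the span.  For B = {x | p ⋢ x} no
-- S ⊆ B contains p, so an element strictly above p can be neither added nor
-- removed; hence every Tₓ with x ≠ p has weighted sum 0, while that of T_p is
-- at least the term S = B, which is 1.  So p has coefficient 0 in any linear
-- relation.

module Submission where

open import Defs
open import Algebra.Bundles using (CommutativeRing)
import Algebra.Properties.Semiring.Exp as Exp
import Algebra.Properties.Semiring.Sum as SemiringSum
open import Data.Fin.Base using (Fin; zero; suc; punchIn)
open import Data.Fin.Properties using (all?; punchInᵢ≢i)
import Data.Fin.Properties as Fin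
open import Data.Fin.Subset
  using (Subset; inside; outside; _∈_; _∉_; _⊆_; _─_; ∁; ⊤)
  renaming (∣_∣ to card)
open import Data.Fin.Subset.Properties
  using (_∈?_; _⊆?_; ∈⊤; x∈p⇒x∉∁p; x∈∁p⇒x∉p; x∉∁p⇒x∈p; x∉p⇒x∈∁p)
open import Data.Nat.Base as ℕ using (ℕ; zero; suc)
import Data.Nat.Properties as ℕ
open import Data.Product.Base using (∃; _×_; _,_; proj₁)
open import Data.Rational.Base as ℚ using (0ℚ; 1ℚ; ½; 1/_)
import Data.Rational.Properties as ℚ
open import Data.Rational.Solver using (module +-*-Solver)
open import Data.Sum.Base using (inj₁; inj₂)
open import Data.Vec.Base using ([]; _∷_; tabulate; here; there)
open import Data.Vec.Properties using (lookup∘tabulate; []=⇒lookup; lookup⇒[]=)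
open import Function.Base using (_∘_)
open import Level using (Level)
open import Relation.Binary.Core using (Rel)
open import Relation.Binary.PropositionalEquality as ≡
  using (_≡_; _≢_; cong; subst)
import Relation.Binary.Reasoning.Setoid as SetoidReasoning
open import Relation.Binary.Structures using (IsDecPartialOrder)
open import Relation.Nullary.Decidable
  using (Dec; yes; no; does; dec-true; _×-dec_; _→-dec_)
open import Relation.Nullary.Negation using (¬_; contradiction)

private module R = CommutativeRing ℝ-commutativeRing

open Exp R.semiring using (_^_)
open SemiringSum R.semiring
  using (sum-cong-≋; sum-replicate-zero; sum-remove; ∑-distrib-+; *-distribˡ-sum)

-- The order on Cauchy reals.

0<1ℚ : 0ℚ ℚ.< 1ℚ
0<1ℚ = ℚ.positive⁻¹ 1ℚ

0<½ : 0ℚ ℚ.< ½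
0<½ = ℚ.positive⁻¹ ½

0<ε*½ : ∀ {ε} → 0ℚ ℚ.< ε → 0ℚ ℚ.< ε ℚ.* ½
0<ε*½ {ε} 0<ε = ℚ.positive⁻¹ (ε ℚ.* ½)
  {{ℚ.pos*pos⇒pos ε {{ℚ.positive 0<ε}} ½}}

a≤∣a∣ : ∀ a → a ℚ.≤ ℚ.∣ a ∣
a≤∣a∣ a with ℚ.≤-total 0ℚ a
... | inj₁ 0≤a = ℚ.≤-reflexive (≡.sym (ℚ.0≤p⇒∣p∣≡p 0≤a))
... | inj₂ a≤0 = ℚ.≤-trans a≤0 (ℚ.0≤∣p∣ a)

∣a-b∣<ε⇒a<b+ε : ∀ {a b ε} → ℚ.∣ a ℚ.- b ∣ ℚ.< ε → a ℚ.< b ℚ.+ ε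
∣a-b∣<ε⇒a<b+ε {a} {b} {ε} ab<ε = subst (ℚ._< b ℚ.+ ε)
  (solve 2 (λ a b → b :+ (a :- b) := a) ≡.refl a b)
  (ℚ.+-monoʳ-< b (ℚ.≤-<-trans (a≤∣a∣ (a ℚ.- b)) ab<ε))
  where open +-*-Solver

eventually-zip : ∀ {X Y Z : ℕ → Set} → (∀ {n} → X n → Y n → Z n) →
  Eventually X → Eventually Y → Eventually Z
eventually-zip f (K , X≥) (L , Y≥) = K ℕ.⊔ L , λ n≥ →
  f (X≥ (ℕ.m⊔n≤o⇒m≤o K L n≥)) (Y≥ (ℕ.m⊔n≤o⇒n≤o K L n≥))

≤-reflexive : ∀ {x y} → x ≈ y → x ≤ y
≤-reflexive x≈y = mk≤ λ ε 0<ε →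
  let K , xy = close x≈y ε 0<ε in K , λ n≥ → ∣a-b∣<ε⇒a<b+ε (xy n≥)

≤-trans : ∀ {x y z} → x ≤ y → y ≤ z → x ≤ z
≤-trans {x} {y} {z} x≤y y≤z = mk≤ λ ε 0<ε →
  eventually-zip (λ {n} xy yz → subst (seq x n ℚ.<_)
      (solve 2 (λ z ε → (z :+ ε :* con ½) :+ ε :* con ½ := z :+ ε) ≡.refl (seq z n) ε)
      (ℚ.<-trans xy (ℚ.+-monoˡ-< (ε ℚ.* ½) yz)))
    (below x≤y (ε ℚ.* ½) (0<ε*½ 0<ε)) (below y≤z (ε ℚ.* ½) (0<ε*½ 0<ε))
  where open +-*-Solver

+-mono-≤ : ∀ {x y u v} → x ≤ y → u ≤ v → x + u ≤ y + v
+-mono-≤ {x} {y} {u} {v} x≤y u≤v = mk≤ λ ε 0<ε →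
  eventually-zip (λ {n} xy uv → subst (seq x n ℚ.+ seq u n ℚ.<_)
      (solve 3 (λ y v ε →
          (y :+ ε :* con ½) :+ (v :+ ε :* con ½) := (y :+ v) :+ ε) ≡.refl
        (seq y n) (seq v n) ε)
      (ℚ.+-mono-< xy uv))
    (below x≤y (ε ℚ.* ½) (0<ε*½ 0<ε)) (below u≤v (ε ℚ.* ½) (0<ε*½ 0<ε))
  where open +-*-Solver

0≤1 : 0ℝ ≤ 1ℝ
0≤1 = mk≤ λ ε 0<ε → 0 , λ _ → ℚ.+-mono-< 0<1ℚ 0<ε

eventuallyBelow : ∀ x → ∃ λ M → 0ℚ ℚ.< M × Eventually λ n → seq x n ℚ.< M
eventuallyBelow x =
  let N , xN = cauchy x 1ℚ 0<1ℚ
  in ℚ.∣ seq x N ∣ ℚ.+ 1ℚ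
   , ℚ.+-mono-≤-< (ℚ.0≤∣p∣ (seq x N)) 0<1ℚ
   , N , λ n≥ → ℚ.<-≤-trans (∣a-b∣<ε⇒a<b+ε (xN n≥ ℕ.≤-refl))
                  (ℚ.+-monoˡ-≤ 1ℚ (a≤∣a∣ (seq x N)))

0≤a⇒0<a*b+ε : ∀ {a b M δ ε} → 0ℚ ℚ.≤ a → a ℚ.< M → 0ℚ ℚ.< δ → M ℚ.* δ ≡ ε →
  0ℚ ℚ.< b ℚ.+ δ → 0ℚ ℚ.< a ℚ.* b ℚ.+ ε
0≤a⇒0<a*b+ε {a} {b} {M} {δ} 0≤a a<M 0<δ ≡.refl 0<b+δ = begin-strict
  0ℚ                                 ≤⟨ ℚ.nonNegative⁻¹ (a ℚ.* (b ℚ.+ δ))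
                                          {{ℚ.nonNeg*nonNeg⇒nonNeg a {{ℚ.nonNegative 0≤a}}
                                            (b ℚ.+ δ) {{ℚ.nonNegative (ℚ.<⇒≤ 0<b+δ)}}}} ⟩
  a ℚ.* (b ℚ.+ δ)                    ≡⟨ ℚ.*-distribˡ-+ a b δ ⟩
  a ℚ.* b ℚ.+ a ℚ.* δ                <⟨ ℚ.+-monoʳ-< (a ℚ.* b)
                                          (ℚ.*-monoˡ-<-pos δ {{ℚ.positive 0<δ}} a<M) ⟩
  a ℚ.* b ℚ.+ M ℚ.* δ                ∎
  where open ℚ.≤-Reasoning

quotient : ∀ {M ε} → 0ℚ ℚ.< M → 0ℚ ℚ.< ε → ∃ λ δ → 0ℚ ℚ.< δ × M ℚ.* δ ≡ ε
quotient {M} {ε} 0<M 0<ε = 1/ M ℚ.* ε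
  , ℚ.positive⁻¹ (1/ M ℚ.* ε)
      {{ℚ.pos*pos⇒pos (1/ M) {{ℚ.1/pos⇒pos M}} ε {{ℚ.positive 0<ε}}}}
  , ≡.trans (≡.sym (ℚ.*-assoc M (1/ M) ε))
      (≡.trans (cong (ℚ._* ε) (ℚ.*-inverseʳ M)) (ℚ.*-identityˡ ε))
  where
  instance
    M-pos : ℚ.Positive M
    M-pos = ℚ.positive 0<M

    M-nonZero : ℚ.NonZero M
    M-nonZero = ℚ.pos⇒nonZero M

-- The sign of a real cannot be decided, but that of each rational approximation can. If `a` is
-- nonnegative, then `0 ≤ a(b + α) < ab + Aα = ab + ε`, and likewise with the factors exchanged; two
-- nonpositive factors have a nonnegative product.
0<a*b+ε : ∀ {a b A B α β ε} → 0ℚ ℚ.< ε →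
  0ℚ ℚ.< α → A ℚ.* α ≡ ε → 0ℚ ℚ.< β → B ℚ.* β ≡ ε →
  a ℚ.< A × 0ℚ ℚ.< b ℚ.+ α → b ℚ.< B × 0ℚ ℚ.< a ℚ.+ β →
  0ℚ ℚ.< a ℚ.* b ℚ.+ ε
0<a*b+ε {a} {b} {ε = ε} 0<ε 0<α Aα≡ε 0<β Bβ≡ε (a<A , 0<b+α) (b<B , 0<a+β)
  with ℚ.≤-total 0ℚ a | ℚ.≤-total 0ℚ b
... | inj₁ 0≤a | _        = 0≤a⇒0<a*b+ε 0≤a a<A 0<α Aα≡ε 0<b+α
... | inj₂ _   | inj₁ 0≤b = subst (λ c → 0ℚ ℚ.< c ℚ.+ ε) (ℚ.*-comm b a)
                              (0≤a⇒0<a*b+ε 0≤b b<B 0<β Bβ≡ε 0<a+β)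
... | inj₂ a≤0 | inj₂ b≤0 = ℚ.+-mono-≤-<
  (ℚ.nonNegative⁻¹ (a ℚ.* b)
    {{ℚ.nonPos*nonPos⇒nonPos a {{ℚ.nonPositive a≤0}} b {{ℚ.nonPositive b≤0}}}})
  0<ε

*-nonNeg : ∀ {x y} → 0ℝ ≤ x → 0ℝ ≤ y → 0ℝ ≤ x * y
*-nonNeg {x} {y} 0≤x 0≤y = mk≤ λ ε 0<ε →
  let A , 0<A , x<A  = eventuallyBelow x
      B , 0<B , y<B  = eventuallyBelow y
      α , 0<α , Aα≡ε = quotient 0<A 0<ε
      β , 0<β , Bβ≡ε = quotient 0<B 0<ε
  in eventually-zip (0<a*b+ε 0<ε 0<α Aα≡ε 0<β Bβ≡ε)
       (eventually-zip _,_ x<A (below 0≤y α 0<α))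
       (eventually-zip _,_ y<B (below 0≤x β 0<β))

-- Tolerance `½` in `1 ≤ t` puts `t` eventually above `½`, so `|c| / 2 ≤ |ct|`. This bounds `c`
-- without constructing an inverse of `t`.
*-cancelʳ-≈0 : ∀ {c t} → 1ℝ ≤ t → c * t ≈ 0ℝ → c ≈ 0ℝ
*-cancelʳ-≈0 {c} {t} 1≤t ct≈0 = mk≈ λ ε 0<ε →
  eventually-zip
    (λ {n} → bound {ε} {seq c n} {seq t n})
    (below 1≤t ½ 0<½) (close ct≈0 (ε ℚ.* ½) (0<ε*½ 0<ε))
  where
  open ℚ.≤-Reasoning
  bound : ∀ {ε a b} → 1ℚ ℚ.< b ℚ.+ ½ → ℚ.∣ a ℚ.* b ℚ.- 0ℚ ∣ ℚ.< ε ℚ.* ½ →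
    ℚ.∣ a ℚ.- 0ℚ ∣ ℚ.< ε
  bound {ε} {a} {b} 1<b+½ ab<ε/2 = ℚ.*-cancelʳ-<-nonNeg ½ (begin-strict
    ℚ.∣ a ℚ.- 0ℚ ∣ ℚ.* ½       ≡⟨ cong (λ a → ℚ.∣ a ∣ ℚ.* ½) (ℚ.+-identityʳ a) ⟩
    ℚ.∣ a ∣ ℚ.* ½              ≤⟨ ℚ.*-monoˡ-≤-nonNeg ℚ.∣ a ∣ {{ℚ.∣-∣-nonNeg a}} (ℚ.<⇒≤ ½<b) ⟩
    ℚ.∣ a ∣ ℚ.* b              ≤⟨ ℚ.*-monoˡ-≤-nonNeg ℚ.∣ a ∣ {{ℚ.∣-∣-nonNeg a}} (a≤∣a∣ b) ⟩
    ℚ.∣ a ∣ ℚ.* ℚ.∣ b ∣        ≡⟨ ℚ.∣p*q∣≡∣p∣*∣q∣ a b ⟨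
    ℚ.∣ a ℚ.* b ∣              ≡⟨ cong ℚ.∣_∣ (ℚ.+-identityʳ (a ℚ.* b)) ⟨
    ℚ.∣ a ℚ.* b ℚ.- 0ℚ ∣       <⟨ ab<ε/2 ⟩
    ε ℚ.* ½                    ∎)
    where
    open +-*-Solver
    ½<b : ½ ℚ.< b
    ½<b = subst (½ ℚ.<_) (solve 1 (λ b → (b :+ con ½) :- con ½ := b) ≡.refl b)
            (ℚ.+-monoˡ-< (ℚ.- ½) 1<b+½)

1≉0 : ¬ 1ℝ ≈ 0ℝ
1≉0 1≈0 = let _ , 1<1 = close 1≈0 1ℚ 0<1ℚ in ℚ.<-irrefl ≡.refl (1<1 ℕ.≤-refl)

-- Real operations act termwise on sequences, so the ring solver for rationals proves identities
-- between reals through this lemma.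
pointwise : ∀ {x y} → (∀ n → seq x n ≡ seq y n) → x ≈ y
pointwise {x} {y} x≗y = mk≈ λ ε 0<ε → 0 , λ {n} _ →
  subst (ℚ._< ε) (≡.sym (cong ℚ.∣_∣
    (≡.trans (cong (ℚ._- seq y n) (x≗y n)) (ℚ.+-inverseʳ (seq y n))))) 0<ε

-- Sums over indices and over subsets.

sum≈0 : ∀ {n} {f : Fin n → ℝ} → (∀ i → f i ≈ 0ℝ) → sum f ≈ 0ℝ
sum≈0 {n} f≈0 = R.trans (sum-cong-≋ f≈0) (sum-replicate-zero n)

sum-single : ∀ {n} {f : Fin n → ℝ} i → (∀ j → j ≢ i → f j ≈ 0ℝ) → sum f ≈ f i
sum-single {suc n} {f} i f≈0 = R.trans (sum-remove {i = i} f)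
  (R.trans (R.+-congˡ (sum≈0 λ j → f≈0 (punchIn i j) (punchInᵢ≢i i j)))
    (R.+-identityʳ (f i)))

-- The sum runs over all subsets, and non-ideals will get weight 0. Splitting on the first element
-- makes it easy to pair subsets with and without a given element.
∑ : ∀ {n} → (Subset n → ℝ) → ℝ
∑ {zero}  f = f []
∑ {suc n} f = ∑ (f ∘ (outside ∷_)) + ∑ (f ∘ (inside ∷_))

∑-cong : ∀ {n} {f g : Subset n → ℝ} → (∀ S → f S ≈ g S) → ∑ f ≈ ∑ g
∑-cong {zero}  f≈g = f≈g []
∑-cong {suc n} f≈g = R.+-cong (∑-cong (f≈g ∘ (outside ∷_))) (∑-cong (f≈g ∘ (inside ∷_)))

∑≈0 : ∀ {n} {f : Subset n → ℝ} → (∀ S → f S ≈ 0ℝ) → ∑ f ≈ 0ℝ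
∑≈0 {zero}  f≈0 = f≈0 []
∑≈0 {suc n} f≈0 = R.trans
  (R.+-cong (∑≈0 (f≈0 ∘ (outside ∷_))) (∑≈0 (f≈0 ∘ (inside ∷_)))) (R.+-identityˡ 0ℝ)

∑-sum : ∀ {n m} (f : Fin m → Subset n → ℝ) →
  ∑ (λ S → sum λ i → f i S) ≈ sum λ i → ∑ (f i)
∑-sum {zero}  f = R.refl
∑-sum {suc n} f = R.trans
  (R.+-cong (∑-sum λ i → f i ∘ (outside ∷_)) (∑-sum λ i → f i ∘ (inside ∷_)))
  (R.sym (∑-distrib-+ (λ i → ∑ (f i ∘ (outside ∷_))) (λ i → ∑ (f i ∘ (inside ∷_)))))

∑-+ : ∀ {n} (f g : Subset n → ℝ) → ∑ (λ S → f S + g S) ≈ ∑ f + ∑ g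
∑-+ {zero}  f g = R.refl
∑-+ {suc n} f g = R.trans
  (R.+-cong (∑-+ (f ∘ (outside ∷_)) (g ∘ (outside ∷_)))
            (∑-+ (f ∘ (inside ∷_)) (g ∘ (inside ∷_))))
  (pointwise λ k → solve 4 (λ a b c d → (a :+ b) :+ (c :+ d) := (a :+ c) :+ (b :+ d)) ≡.refl
    (seq (∑ (f ∘ (outside ∷_))) k) (seq (∑ (g ∘ (outside ∷_))) k)
    (seq (∑ (f ∘ (inside ∷_))) k) (seq (∑ (g ∘ (inside ∷_))) k))
  where open +-*-Solver

*-distribˡ-∑ : ∀ {n} c (f : Subset n → ℝ) → c * ∑ f ≈ ∑ (λ S → c * f S)
*-distribˡ-∑ {zero}  c f = R.refl
*-distribˡ-∑ {suc n} c f = R.trans (R.distribˡ c _ _)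
  (R.+-cong (*-distribˡ-∑ c (f ∘ (outside ∷_)))
            (*-distribˡ-∑ c (f ∘ (inside ∷_))))

∑-nonNeg : ∀ {n} {f : Subset n → ℝ} → (∀ S → 0ℝ ≤ f S) → 0ℝ ≤ ∑ f
∑-nonNeg {zero}  0≤f = 0≤f []
∑-nonNeg {suc n} 0≤f = ≤-trans (≤-reflexive (R.sym (R.+-identityˡ 0ℝ)))
  (+-mono-≤ (∑-nonNeg (0≤f ∘ (outside ∷_))) (∑-nonNeg (0≤f ∘ (inside ∷_))))

term≤∑ : ∀ {n} {f : Subset n → ℝ} → (∀ S → 0ℝ ≤ f S) → ∀ S → f S ≤ ∑ f
term≤∑ 0≤f []            = ≤-reflexive R.refl
term≤∑ 0≤f (outside ∷ S) = ≤-trans (≤-reflexive (R.sym (R.+-identityʳ _)))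
  (+-mono-≤ (term≤∑ (0≤f ∘ (outside ∷_)) S) (∑-nonNeg (0≤f ∘ (inside ∷_))))
term≤∑ 0≤f (inside ∷ S)  = ≤-trans (≤-reflexive (R.sym (R.+-identityˡ _)))
  (+-mono-≤ (∑-nonNeg (0≤f ∘ (outside ∷_))) (term≤∑ (0≤f ∘ (inside ∷_)) S))

-- Pairs of subsets that differ in one element.

infix 4 _⋖[_]_

-- A ⋖[ x ] C means that C is the disjoint union of A and {x}.
data _⋖[_]_ : ∀ {n} → Subset n → Fin n → Subset n → Set where
  here  : ∀ {n} {S : Subset n} → outside ∷ S ⋖[ zero ] inside ∷ S
  there : ∀ {n s x} {A C : Subset n} → A ⋖[ x ] C → s ∷ A ⋖[ suc x ] s ∷ C

⋖⇒∉ : ∀ {n x} {A C : Subset n} → A ⋖[ x ] C → x ∉ A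
⋖⇒∉ (there A⋖C) (there x∈A) = ⋖⇒∉ A⋖C x∈A

⋖⇒∈ : ∀ {n x} {A C : Subset n} → A ⋖[ x ] C → x ∈ C
⋖⇒∈ here        = here
⋖⇒∈ (there A⋖C) = there (⋖⇒∈ A⋖C)

⋖⇒⊆ : ∀ {n x} {A C : Subset n} → A ⋖[ x ] C → A ⊆ C
⋖⇒⊆ here        (there y∈A) = there y∈A
⋖⇒⊆ (there A⋖C) here        = here
⋖⇒⊆ (there A⋖C) (there y∈A) = there (⋖⇒⊆ A⋖C y∈A)

⋖⇒⊇ : ∀ {n x y} {A C : Subset n} → A ⋖[ x ] C → y ≢ x → y ∈ C → y ∈ A
⋖⇒⊇ here        y≢x here        = contradiction ≡.refl y≢x
⋖⇒⊇ here        y≢x (there y∈C) = there y∈C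
⋖⇒⊇ (there A⋖C) y≢x here        = here
⋖⇒⊇ (there A⋖C) y≢x (there y∈C) = there (⋖⇒⊇ A⋖C (y≢x ∘ cong suc) y∈C)

-- Source of the extra factor `q`: `B ─ A` has just one element more than `B ─ C`, namely `x`.
card-─-⋖ : ∀ {n x} {A B C : Subset n} → A ⋖[ x ] C → x ∈ B →
  card (B ─ A) ≡ suc (card (B ─ C))
card-─-⋖ here here = ≡.refl
card-─-⋖ {A = inside ∷ _} (there A⋖C) (there x∈B) = card-─-⋖ A⋖C x∈B
card-─-⋖ {A = outside ∷ _} {B = outside ∷ _} (there A⋖C) (there x∈B) =
  card-─-⋖ A⋖C x∈B
card-─-⋖ {A = outside ∷ _} {B = inside ∷ _} (there A⋖C) (there x∈B) =
  cong suc (card-─-⋖ A⋖C x∈B)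

card-p─p : ∀ {n} (S : Subset n) → card (S ─ S) ≡ 0
card-p─p []            = ≡.refl
card-p─p (inside  ∷ S) = card-p─p S
card-p─p (outside ∷ S) = card-p─p S

-- Every subset lies in exactly one such pair. For `zero` the two halves of `∑` are matched with
-- each other; for `suc x` each half contains its own pairs.
∑-pairs : ∀ {n} {f : Subset n → ℝ} x →
  (∀ {A C} → A ⋖[ x ] C → f A + f C ≈ 0ℝ) → ∑ f ≈ 0ℝ
∑-pairs {f = f} zero fA+fC≈0 =
  R.trans (R.sym (∑-+ (f ∘ (outside ∷_)) (f ∘ (inside ∷_))))
    (∑≈0 λ S → fA+fC≈0 (here {S = S}))
∑-pairs (suc x) fA+fC≈0 = R.trans
  (R.+-cong (∑-pairs x (fA+fC≈0 ∘ there)) (∑-pairs x (fA+fC≈0 ∘ there)))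
  (R.+-identityˡ 0ℝ)

^-nonNeg : ∀ {q} → 0ℝ ≤ q → ∀ k → 0ℝ ≤ q ^ k
^-nonNeg 0≤q zero    = 0≤1
^-nonNeg 0≤q (suc k) = *-nonNeg 0≤q (^-nonNeg 0≤q k)

-- Weighted sums over ideals.

module Expectation {ℓ} {n : ℕ} {_⊑_ : Rel (Fin n) ℓ}
  (P : IsDecPartialOrder _≡_ _⊑_) (q : ℝ) where

  open Toggleability P
  open IsDecPartialOrder P using ()
    renaming (_≤?_ to _⊑?_; refl to ⊑-refl; trans to ⊑-trans; antisym to ⊑-antisym)

  module _ {a} {X : Set a} where

    indicator-true : (X? : Dec X) → X → indicator X? ≡ 1ℝ
    indicator-true (yes _) _ = ≡.refl
    indicator-true (no ¬x) x = contradiction x ¬x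

    indicator-false : (X? : Dec X) → ¬ X → indicator X? ≡ 0ℝ
    indicator-false (yes x) ¬x = contradiction x ¬x
    indicator-false (no _)  _  = ≡.refl

    indicator-nonNeg : (X? : Dec X) → 0ℝ ≤ indicator X?
    indicator-nonNeg (yes _) = 0≤1
    indicator-nonNeg (no _)  = ≤-reflexive R.refl

  module _ {a b} {X : Set a} {Y : Set b} where

    indicator-⇔ : (X? : Dec X) (Y? : Dec Y) → (X → Y) → (Y → X) →
      indicator X? ≡ indicator Y?
    indicator-⇔ (yes x) Y? f g = ≡.sym (indicator-true Y? (f x))
    indicator-⇔ (no ¬x) Y? f g = ≡.sym (indicator-false Y? (¬x ∘ g))

    indicator-× : (X? : Dec X) (Y? : Dec Y) →
      indicator X? * indicator Y? ≈ indicator (X? ×-dec Y?)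
    indicator-× (yes _) Y? = R.*-identityˡ (indicator Y?)
    indicator-× (no _)  Y? = R.zeroˡ (indicator Y?)

  -- The arguments are ordered so that nested `all?` and `→-dec` decide the property, which lets it
  -- enter an `indicator`.
  IsIdeal : Subset n → Set ℓ
  IsIdeal S = ∀ y → y ∈ S → ∀ x → x ⊑ y → x ∈ S

  isIdeal? : ∀ S → Dec (IsIdeal S)
  isIdeal? S = all? λ y → (y ∈? S) →-dec all? λ x → (x ⊑? y) →-dec (x ∈? S)

  IsIdealWithin : Subset n → Subset n → Set ℓ
  IsIdealWithin B S = IsIdeal S × S ⊆ B

  isIdealWithin? : ∀ B S → Dec (IsIdealWithin B S)
  isIdealWithin? B S = isIdeal? S ×-dec (S ⊆? B)

  weight : Subset n → Subset n → ℝ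
  weight B S = indicator (isIdealWithin? B S) * q ^ card (B ─ S)

  E : Subset n → (Subset n → ℝ) → ℝ
  E B f = ∑ λ S → weight B S * f S

  -- The toggleability statistics extended to all subsets. At `members I` they are `T⁺`, `T⁻` and
  -- `T q` by definition.
  τ⁺ τ⁻ τ : Fin n → Subset n → ℝ
  τ⁺ x S = indicator (isMinimalIn? x (∁ S))
  τ⁻ x S = indicator (isMaximalIn? x S)
  τ x S = τ⁺ x S - q * τ⁻ x S

  -- Outside the ideals within `B` the weight is 0, so the values there do not count.
  E-cong : ∀ {B} {f g : Subset n → ℝ} →
    (∀ S → IsIdealWithin B S → f S ≈ g S) → E B f ≈ E B g
  E-cong {B} {f} {g} f≈g = ∑-cong λ S → lemma S (isIdealWithin? B S)
    where
    -- The decision is an argument, so that matching on it reduces the indicator on both sides.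
    lemma : ∀ S (D : Dec (IsIdealWithin B S)) →
      indicator D * q ^ card (B ─ S) * f S ≈ indicator D * q ^ card (B ─ S) * g S
    lemma S (yes i) = R.*-congˡ (f≈g S i)
    lemma S (no _)  = R.trans (R.*-congʳ (R.zeroˡ _)) (R.trans (R.zeroˡ _)
      (R.sym (R.trans (R.*-congʳ (R.zeroˡ _)) (R.zeroˡ _))))

  E-0 : ∀ B → E B (λ _ → 0ℝ) ≈ 0ℝ
  E-0 B = ∑≈0 λ S → R.zeroʳ (weight B S)

  -- Linearity of `E B`, which turns a relation among statistics into a relation among their
  -- weighted sums.
  E-linearCombination : ∀ B {m} (c : Fin m → ℝ) (f : Fin m → Subset n → ℝ) →
    E B (linearCombination c f) ≈ sum λ i → c i * E B (f i)
  E-linearCombination B c f = begin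
    ∑ (λ S → weight B S * linearCombination c f S)
      ≈⟨ ∑-cong (λ S → R.trans (*-distribˡ-sum (weight B S) λ i → c i * f i S)
           (sum-cong-≋ λ i → x∙yz≈y∙xz (weight B S) (c i) (f i S))) ⟩
    ∑ (λ S → sum λ i → c i * (weight B S * f i S))
      ≈⟨ ∑-sum (λ i S → c i * (weight B S * f i S)) ⟩
    sum (λ i → ∑ λ S → c i * (weight B S * f i S))
      ≈⟨ sum-cong-≋ (λ i → *-distribˡ-∑ (c i) λ S → weight B S * f i S) ⟨
    sum (λ i → c i * E B (f i)) ∎
    where
    open SetoidReasoning R.setoid
    x∙yz≈y∙xz : ∀ x y z → x * (y * z) ≈ y * (x * z)
    x∙yz≈y∙xz x y z = pointwise λ k →
      solve 3 (λ x y z → x :* (y :* z) := y :* (x :* z)) ≡.refl (seq x k) (seq y k) (seq z k)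
      where open +-*-Solver

  -- The exponent is 0 and `q ^ 0` is 1 even for `q = 0`, so the term at `B` always survives.
  weight-self : ∀ {B} → IsIdeal B → weight B B ≈ 1ℝ
  weight-self {B} ideal = R.trans
    (R.*-cong (R.reflexive (indicator-true (isIdealWithin? B B) (ideal , λ x∈B → x∈B)))
              (R.reflexive (cong (q ^_) (card-p─p B))))
    (R.*-identityʳ 1ℝ)

  -- The term at `S = B` is already 1, and `0ℝ ≤ q` makes all other terms nonnegative.
  1≤E : 0ℝ ≤ q → ∀ {B} {f : Subset n → ℝ} →
    IsIdeal B → (∀ S → 0ℝ ≤ f S) → f B ≈ 1ℝ → 1ℝ ≤ E B f
  1≤E 0≤q {B} {f} ideal 0≤f fB≈1 = ≤-trans
    (≤-reflexive (R.sym (R.trans (R.*-cong (weight-self ideal) fB≈1) (R.*-identityʳ 1ℝ))))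
    (term≤∑ (λ S → *-nonNeg (*-nonNeg (indicator-nonNeg (isIdealWithin? B S))
      (^-nonNeg 0≤q (card (B ─ S)))) (0≤f S)) B)

  -- Adding and removing one element.

  module _ {B : Subset n} {x : Fin n} (x∈B : x ∈ B) {A C : Subset n} (A⋖C : A ⋖[ x ] C) where

    addable⇒removable : IsIdealWithin B A × IsMinimalIn x (∁ A) →
      IsIdealWithin B C × IsMaximalIn x C
    addable⇒removable ((ideal , A⊆B) , _ , minimal) =
      (idealC , C⊆B) , ⋖⇒∈ A⋖C , maximal
      where
      below-x : ∀ {z} → z ⊑ x → z ∈ C
      below-x {z} z⊑x with z ∈? A
      ... | yes z∈A = ⋖⇒⊆ A⋖C z∈A
      -- An element below `x` and outside `A` is `x` itself, by minimality in the complement.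
      ... | no z∉A  = subst (_∈ C) (≡.sym (minimal z (x∉p⇒x∈∁p z∉A) z⊑x)) (⋖⇒∈ A⋖C)

      idealC : IsIdeal C
      idealC y y∈C z z⊑y with y Fin.≟ x
      ... | yes ≡.refl = below-x z⊑y
      ... | no y≢x     = ⋖⇒⊆ A⋖C (ideal y (⋖⇒⊇ A⋖C y≢x y∈C) z z⊑y)

      C⊆B : C ⊆ B
      C⊆B {y} y∈C with y Fin.≟ x
      ... | yes ≡.refl = x∈B
      ... | no y≢x     = A⊆B (⋖⇒⊇ A⋖C y≢x y∈C)

      maximal : ∀ y → y ∈ C → x ⊑ y → y ≡ x
      maximal y y∈C x⊑y with y Fin.≟ x
      ... | yes y≡x = y≡x
      -- Such a `y` would lie in the ideal `A` above `x`, forcing `x` into `A`.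
      ... | no y≢x  = contradiction (ideal y (⋖⇒⊇ A⋖C y≢x y∈C) x x⊑y) (⋖⇒∉ A⋖C)

    removable⇒addable : IsIdealWithin B C × IsMaximalIn x C →
      IsIdealWithin B A × IsMinimalIn x (∁ A)
    removable⇒addable ((ideal , C⊆B) , _ , maximal) =
      (idealA , λ y∈A → C⊆B (⋖⇒⊆ A⋖C y∈A)) , x∉p⇒x∈∁p (⋖⇒∉ A⋖C) , minimal
      where
      idealA : IsIdeal A
      idealA y y∈A z z⊑y with z Fin.≟ x
      -- Here `y` lies above `x` in `C`, so maximality gives `y ≡ x`, although `y` is in `A` and `x`
      -- is not.
      ... | yes ≡.refl = contradiction
        (subst (_∈ A) (maximal y (⋖⇒⊆ A⋖C y∈A) z⊑y) y∈A) (⋖⇒∉ A⋖C)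
      ... | no z≢x     = ⋖⇒⊇ A⋖C z≢x (ideal y (⋖⇒⊆ A⋖C y∈A) z z⊑y)

      minimal : ∀ y → y ∈ ∁ A → y ⊑ x → y ≡ x
      minimal y y∈∁A y⊑x with y Fin.≟ x
      ... | yes y≡x = y≡x
      ... | no y≢x  = contradiction
        (⋖⇒⊇ A⋖C y≢x (ideal x (⋖⇒∈ A⋖C) y y⊑x)) (x∈∁p⇒x∉p y∈∁A)

    -- Adding `x` to `A` and removing it from `C` are inverse moves between ideals within `B`, so
    -- the two indicator products record equivalent conditions.
    addable≈removable :
      indicator (isIdealWithin? B A) * τ⁺ x A ≈ indicator (isIdealWithin? B C) * τ⁻ x C
    addable≈removable = begin
      indicator (isIdealWithin? B A) * τ⁺ x A
        ≈⟨ indicator-× (isIdealWithin? B A) (isMinimalIn? x (∁ A)) ⟩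
      indicator (isIdealWithin? B A ×-dec isMinimalIn? x (∁ A))
        ≡⟨ indicator-⇔ (isIdealWithin? B A ×-dec isMinimalIn? x (∁ A))
             (isIdealWithin? B C ×-dec isMaximalIn? x C) addable⇒removable removable⇒addable ⟩
      indicator (isIdealWithin? B C ×-dec isMaximalIn? x C)
        ≈⟨ indicator-× (isIdealWithin? B C) (isMaximalIn? x C) ⟨
      indicator (isIdealWithin? B C) * τ⁻ x C ∎
      where open SetoidReasoning R.setoid

  τ⁻-∉ : ∀ {x S} → x ∉ S → τ⁻ x S ≡ 0ℝ
  τ⁻-∉ {x} {S} x∉S = indicator-false (isMaximalIn? x S) (x∉S ∘ proj₁)

  τ⁺-∈ : ∀ {x S} → x ∈ S → τ⁺ x S ≡ 0ℝ
  τ⁺-∈ {x} {S} x∈S = indicator-false (isMinimalIn? x (∁ S)) (x∈p⇒x∉∁p x∈S ∘ proj₁)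

  τ-∉ : ∀ {x S} → x ∉ S → τ x S ≈ τ⁺ x S
  τ-∉ {x} {S} x∉S = begin
    τ⁺ x S - q * τ⁻ x S  ≡⟨ cong (λ t → τ⁺ x S - q * t) (τ⁻-∉ x∉S) ⟩
    τ⁺ x S - q * 0ℝ      ≈⟨ pointwise (λ k →
                              solve 2 (λ t q → t :- q :* con 0ℚ := t) ≡.refl
                                (seq (τ⁺ x S) k) (seq q k)) ⟩
    τ⁺ x S               ∎
    where
    open SetoidReasoning R.setoid
    open +-*-Solver

  -- Cancellation occurs inside each pair: only `τ⁺` contributes at `A`, where the weight has the
  -- extra factor `q`, and only `- q * τ⁻` at `C`. Nothing is divided by `q`, so `q = 0` is covered.
  E-τ-∈ : ∀ {B x} → x ∈ B → E B (τ x) ≈ 0ℝ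
  E-τ-∈ {B} {x} x∈B = ∑-pairs x λ {A} {C} A⋖C →
    let i = indicator (isIdealWithin? B A)
        j = indicator (isIdealWithin? B C)
        t = τ⁺ x A
        s = τ⁻ x C
        w = q ^ card (B ─ C)
    in begin
      weight B A * τ x A + weight B C * τ x C
        ≈⟨ R.+-cong
             (R.*-cong (R.*-congˡ (R.reflexive (cong (q ^_) (card-─-⋖ A⋖C x∈B))))
                       (τ-∉ (⋖⇒∉ A⋖C)))
             (R.*-congˡ (R.reflexive (cong (λ t → t - q * s) (τ⁺-∈ (⋖⇒∈ A⋖C))))) ⟩
      i * (q * w) * t + j * w * (0ℝ - q * s)
        ≈⟨ pointwise (λ k → solve 6 (λ i j t s q w →
             i :* (q :* w) :* t :+ j :* w :* (con 0ℚ :- q :* s)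
               := q :* w :* (i :* t :- j :* s)) ≡.refl
             (seq i k) (seq j k) (seq t k) (seq s k) (seq q k) (seq w k)) ⟩
      q * w * (i * t - j * s)
        ≈⟨ R.*-congˡ (R.trans (R.+-congʳ (addable≈removable x∈B A⋖C)) (R.-‿inverseʳ (j * s))) ⟩
      q * w * 0ℝ
        ≈⟨ R.zeroʳ (q * w) ⟩
      0ℝ ∎
    where
    open SetoidReasoning R.setoid
    open +-*-Solver

  -- The ideal of elements not above `p`.

  notAbove : Fin n → Subset n
  notAbove p = ∁ (tabulate λ x → does (p ⊑? x))

  ⊑⇒∉notAbove : ∀ {p x} → p ⊑ x → x ∉ notAbove p
  ⊑⇒∉notAbove {p} {x} p⊑x = x∈p⇒x∉∁p (lookup⇒[]= x _
    (≡.trans (lookup∘tabulate (λ y → does (p ⊑? y)) x) (dec-true (p ⊑? x) p⊑x)))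

  ∉notAbove⇒⊑ : ∀ {p x} → x ∉ notAbove p → p ⊑ x
  ∉notAbove⇒⊑ {p} {x} x∉ = does≡true⇒ (p ⊑? x)
    (≡.trans (≡.sym (lookup∘tabulate (λ y → does (p ⊑? y)) x)) ([]=⇒lookup (x∉∁p⇒x∈p x∉)))
    where
    does≡true⇒ : ∀ {a} {X : Set a} (X? : Dec X) → does X? ≡ inside → X
    does≡true⇒ (yes x) _ = x

  notAbove-isIdeal : ∀ p → IsIdeal (notAbove p)
  notAbove-isIdeal p y y∈ x x⊑y with x ∈? notAbove p
  ... | yes x∈ = x∈
  -- If `p` were below `x`, it would be below `y` by transitivity.
  ... | no x∉  = contradiction y∈ (⊑⇒∉notAbove (⊑-trans (∉notAbove⇒⊑ x∉) x⊑y))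

  E-τ-≢ : ∀ {p x} → x ≢ p → E (notAbove p) (τ x) ≈ 0ℝ
  E-τ-≢ {p} {x} x≢p with x ∈? notAbove p
  ... | yes x∈ = E-τ-∈ x∈
  -- Now `p` lies strictly below `x` and outside every `S` considered, so `x` is neither in `S` nor
  -- minimal in its complement.
  ... | no x∉  = R.trans (E-cong vanish) (E-0 (notAbove p))
    where
    vanish : ∀ S → IsIdealWithin (notAbove p) S → τ x S ≈ 0ℝ
    vanish S (_ , S⊆) = R.trans (τ-∉ (x∉ ∘ S⊆))
      (R.reflexive (indicator-false (isMinimalIn? x (∁ S)) λ (_ , minimal) →
        x≢p (≡.sym (minimal p (x∉p⇒x∈∁p (⊑⇒∉notAbove ⊑-refl ∘ S⊆)) (∉notAbove⇒⊑ x∉)))))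

  -- The complement of `notAbove p` is the set of elements above `p`, with least element `p`. The
  -- bound is first proved for `τ⁺`, which is nonnegative on every subset, and then moved to `τ`,
  -- which agrees with it on ideals avoiding `p`.
  1≤E-τ-self : 0ℝ ≤ q → ∀ p → 1ℝ ≤ E (notAbove p) (τ p)
  1≤E-τ-self 0≤q p = ≤-trans
    (1≤E 0≤q (notAbove-isIdeal p) (λ S → indicator-nonNeg (isMinimalIn? p (∁ S)))
      (R.reflexive (indicator-true (isMinimalIn? p (∁ (notAbove p)))
        (x∉p⇒x∈∁p p∉ , λ x x∈ x⊑p → ⊑-antisym x⊑p (∉notAbove⇒⊑ (x∈∁p⇒x∉p x∈))))))
    (≤-reflexive (R.sym (E-cong λ S (_ , S⊆) → τ-∉ (p∉ ∘ S⊆))))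
    where
    p∉ : p ∉ notAbove p
    p∉ = ⊑⇒∉notAbove ⊑-refl

  -- Bridge from hypotheses about `OrderIdeal` to sums over subsets: each subset of nonzero weight
  -- underlies an order ideal.
  E-on-ideals : ∀ B {f g : Subset n → ℝ} →
    (∀ (I : OrderIdeal) → f (members I) ≈ g (members I)) → E B f ≈ E B g
  E-on-ideals B f≈g = E-cong λ S (ideal , _) →
    f≈g record { members = S ; downClosed = λ {x} {y} x⊑y y∈S → ideal y y∈S x x⊑y }

  T-linearlyIndependent : 0ℝ ≤ q → LinearlyIndependent (T q)
  T-linearlyIndependent 0≤q c ΣcT≈0 p = *-cancelʳ-≈0 (1≤E-τ-self 0≤q p) (begin
    -- Applying `E B` to the relation leaves only the summand of `p`, whose factor `E B (τ p)` is at
    -- least 1 and can be cancelled.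
    c p * E B (τ p)               ≈⟨ sum-single p (λ x x≢p →
                                       R.trans (R.*-congˡ (E-τ-≢ x≢p)) (R.zeroʳ (c x))) ⟨
    sum (λ x → c x * E B (τ x))   ≈⟨ E-linearCombination B c τ ⟨
    E B (linearCombination c τ)   ≈⟨ E-on-ideals B ΣcT≈0 ⟩
    E B (λ _ → 0ℝ)                ≈⟨ E-0 B ⟩
    0ℝ                            ∎)
    where
    open SetoidReasoning R.setoid
    B = notAbove p

  1∉Span-T : 0ℝ ≤ q → ¬ ((λ _ → 1ℝ) ∈Span T q)
  -- Cancellation is used with coefficient 1: `E ⊤` of the constant 1 is at least 1, yet membership
  -- in the span would make it 0.
  1∉Span-T 0≤q (c , 1≈ΣcT) = 1≉0 (*-cancelʳ-≈0
    (1≤E 0≤q {⊤} (λ _ _ _ _ → ∈⊤) (λ _ → 0≤1) R.refl) (begin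
    1ℝ * E ⊤ (λ _ → 1ℝ)           ≈⟨ R.*-identityˡ _ ⟩
    E ⊤ (λ _ → 1ℝ)                ≈⟨ E-on-ideals ⊤ 1≈ΣcT ⟩
    E ⊤ (linearCombination c τ)   ≈⟨ E-linearCombination ⊤ c τ ⟩
    sum (λ x → c x * E ⊤ (τ x))   ≈⟨ sum≈0 (λ x →
                                       R.trans (R.*-congˡ (E-τ-∈ ∈⊤)) (R.zeroʳ (c x))) ⟩
    0ℝ                            ∎))
    where open SetoidReasoning R.setoid

theorem2p7 : ∀ {ℓ : Level} (n : ℕ) (_⊑_ : Rel (Fin n) ℓ)
    (P : IsDecPartialOrder _≡_ _⊑_) (q : ℝ) → 0ℝ ≤ q →
    LinearlyIndependent (Toggleability.T P q) × ¬ ((λ _ → 1ℝ) ∈Span Toggleability.T P q)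
theorem2p7 n _⊑_ P q 0≤q = T-linearlyIndependent 0≤q , 1∉Span-T 0≤q
  where open Expectation P q
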